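{- Transitive tournaments and the tournaments $\Delta(1,1,k)$ ($k\ge 1$) are heroes in orientations of chordal graphs. More precisely, for every integer $k\geq 1$: every orientation of a chordal graph with no induced copy of $TT_k$ has dichromatic number at most $2^{k-1}-1$, and every orientation of a chordal graph with no induced copy of $\Delta(1,1,k)$ has dichromatic number at most $2^{2k-2}$.
   Context: All digraphs are finite and simple (no loops, no parallel arcs, no digons). An orientation of a chordal graph is a digraph whose underlying undirected graph has no induced cycle of length at least $4$. The dichromatic number $\vec{\chi}(G)$ of a digraph $G$ is the least $k$ such that $V(G)$ can be partitioned into $k$ sets each inducing an acyclic subdigraph. A digraph is $H$-free if it contains no induced copy of $H$; $H$ is a hero in a hereditary class $\mathcal{C}$ if $H$-free digraphs in $\mathcal{C}$ have bounded dichromatic number. $TT_k$ denotes the transitive (acyclic) tournament on $k$ vertices. $\Delta(1,1,k)$ is the tournament with vertices $x,y$ and a copy $T$ of $TT_k$, with arcs $x\to y$, $y\to t$ and $t\to x$ for all $t\in V(T)$ (plus the arcs inside $T$). -}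

module Defs where

open import Data.Nat using (ℕ; zero; suc; _+_; _∸_; _^_; _<ᵇ_; _≤_)
open import Data.Fin using (Fin; zero; suc; toℕ; inject₁; fromℕ)
open import Data.Bool using (Bool; true; false; _∨_)
open import Data.Product using (Σ; _×_; _,_; ∃)
open import Data.Sum using (_⊎_)
open import Data.Empty using (⊥)
open import Relation.Nullary using (¬_)
open import Relation.Binary.PropositionalEquality using (_≡_)
open import Function.Definitions using (Injective)

record Digraph (n : ℕ) : Set where
  field
    arc     : Fin n → Fin n → Bool
    irrefl  : ∀ v → arc v v ≡ false
    asym    : ∀ u v → arc u v ≡ true → arc v u ≡ false
open Digraph public

adj : ∀ {n} → Digraph n → Fin n → Fin n → Bool
adj G u v = arc G u v ∨ arc G v u

CycAdj : (m : ℕ) → Fin m → Fin m → Set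
CycAdj m i j =
  (suc (toℕ i) ≡ toℕ j) ⊎ (suc (toℕ j) ≡ toℕ i)
  ⊎ ((toℕ i ≡ 0) × (suc (toℕ j) ≡ m)) ⊎ ((toℕ j ≡ 0) × (suc (toℕ i) ≡ m))

InducedCycle : ∀ {n} → Digraph n → ℕ → Set
InducedCycle {n} G m =
  Σ (Fin m → Fin n) λ c →
    Injective _≡_ _≡_ c ×
    (∀ i j → (adj G (c i) (c j) ≡ true → CycAdj m i j)
           × (CycAdj m i j → adj G (c i) (c j) ≡ true))

Chordal : ∀ {n} → Digraph n → Set
Chordal G = ∀ m → 4 ≤ m → ¬ InducedCycle G m

ContainsInduced : ∀ {h n} → Digraph h → Digraph n → Set
ContainsInduced {h} {n} H G =
  Σ (Fin h → Fin n) λ f →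
    Injective _≡_ _≡_ f × (∀ u v → arc G (f u) (f v) ≡ arc H u v)

_-free : ∀ {h n} → Digraph n → Digraph h → Set
(G -free) H = ¬ ContainsInduced H G

DirectedCycleIn : ∀ {n} → Digraph n → (Fin n → Set) → Set
DirectedCycleIn {n} G P =
  Σ ℕ λ m → Σ (Fin (suc m) → Fin n) λ c →
    Injective _≡_ _≡_ c ×
    (∀ i → P (c i)) ×
    (∀ (i : Fin m) → arc G (c (inject₁ i)) (c (suc i)) ≡ true) ×
    (arc G (c (fromℕ m)) (c zero) ≡ true)

DichromaticAtMost : ∀ {n} → Digraph n → ℕ → Set
DichromaticAtMost {n} G b =
  Σ (Fin n → Fin b) λ col →
    ∀ (a : Fin b) → ¬ DirectedCycleIn G (λ v → col v ≡ a)

private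
  lt-irrefl : ∀ {k} (v : Fin k) → (toℕ v <ᵇ toℕ v) ≡ false
  lt-irrefl v = go (toℕ v)
    where
      go : ∀ x → (x <ᵇ x) ≡ false
      go zero = Relation.Binary.PropositionalEquality.refl
      go (suc x) = go x
  lt-asym′ : ∀ x y → (x <ᵇ y) ≡ true → (y <ᵇ x) ≡ false
  lt-asym′ zero zero ()
  lt-asym′ zero (suc y) _ = Relation.Binary.PropositionalEquality.refl
  lt-asym′ (suc x) zero ()
  lt-asym′ (suc x) (suc y) p = lt-asym′ x y p

TT : (k : ℕ) → Digraph k
TT k = record
  { arc = λ i j → toℕ i <ᵇ toℕ j
  ; irrefl = lt-irrefl
  ; asym = λ u v → lt-asym′ (toℕ u) (toℕ v) }

-- Δ(1,1,k) on Fin (2+k): zero = x, suc zero = y, suc (suc t) = t ∈ TT_k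
-- arcs: x → y, y → t, t → x, and the arcs of TT_k among the t's
Δarc : (k : ℕ) → Fin (suc (suc k)) → Fin (suc (suc k)) → Bool
Δarc k zero zero = false
Δarc k zero (suc zero) = true
Δarc k zero (suc (suc t)) = false
Δarc k (suc zero) zero = false
Δarc k (suc zero) (suc zero) = false
Δarc k (suc zero) (suc (suc t)) = true
Δarc k (suc (suc t)) zero = true
Δarc k (suc (suc t)) (suc zero) = false
Δarc k (suc (suc s)) (suc (suc t)) = arc (TT k) s t

Δ11 : (k : ℕ) → Digraph (suc (suc k))
Δ11 k = record { arc = Δarc k ; irrefl = irr ; asym = as }
  where
    open Relation.Binary.PropositionalEquality using (refl)
    irr : ∀ v → Δarc k v v ≡ false
    irr zero = refl
    irr (suc zero) = refl
    irr (suc (suc t)) = irrefl (TT k) t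
    as : ∀ u v → Δarc k u v ≡ true → Δarc k v u ≡ false
    as zero zero ()
    as zero (suc zero) _ = refl
    as zero (suc (suc t)) ()
    as (suc zero) zero ()
    as (suc zero) (suc zero) ()
    as (suc zero) (suc (suc t)) _ = refl
    as (suc (suc t)) zero _ = refl
    as (suc (suc t)) (suc zero) ()
    as (suc (suc s)) (suc (suc t)) p = asym (TT k) s t p

{-# OPTIONS --safe #-}
module Submission where

-- A chordal graph has a simplicial vertex w: take a maximal connected set C whose
-- non-neighbours R are not empty. By maximality the neighbours of C are complete to R, hence
-- form a clique (two non-adjacent ones would lie on a long induced cycle through C and R), and
-- a simplicial vertex of R, found inductively, is simplicial in the whole graph. Colour the
-- vertices greedily along such an elimination order. A colour class stays acyclic as long
-- as w creates no monochromatic directed triangle with the clique K of its coloured neighbours.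
--
-- TT_k: if all 2^(k-1) - 1 colours occur on K, then K with w contains a tournament on
-- 2^(k-1) vertices, hence a TT_k.
--
-- Δ(1,1,k): if each colour c is blocked by a triangle w → a_c → d_c → w, the 2^(2k-2) distinct
-- vertices d_c contain a TT_(2k-1); let d be its source and a the corresponding a_c. Of the other
-- 2k-2 vertices e, either k-1 satisfy a → e, and then w, a and {d, e, ...} form a Δ(1,1,k), or
-- k-1 satisfy e → a, and then a, d and {e, ..., w} form one.

open import Defs
open import Data.Nat using (ℕ; _≤_; _^_; _∸_; _*_)
open import Data.Product using (_×_)
open import Data.Bool using (true; false; _∨_; if_then_else_)
open import Data.Bool.Properties using (∨-comm; ∨-zeroʳ; T-≡) renaming (_≟_ to _≟ᵇ_)
open import Data.Fin using (Fin; zero; suc; toℕ; fromℕ; fromℕ<; inject₁; inject≤)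
open import Data.Fin.Properties using (_≟_; all?; ¬∀⟶∃¬; toℕ-injective; toℕ-fromℕ; toℕ-inject≤; <-cmp)
open import Data.List using (List; []; _∷_; [_]; _++_; length; lookup; filter; map; tabulate; allFin)
open import Data.List.Extrema.Nat using (max; max≤v⁺; xs≤max)
open import Data.List.Membership.Propositional using (_∈_; find; lose)
open import Data.List.Membership.Propositional.Properties using (∈-filter⁺; ∈-filter⁻; ∈-tabulate⁻; ∈-lookup; ∈-map⁺; ∈-allFin)
open import Data.List.Properties using (filter-notAll; length-tabulate; length-++)
open import Data.List.Relation.Unary.All as All using (All; []; _∷_)
open import Data.List.Relation.Unary.All.Properties as All using (¬Any⇒All¬; all-filter)
open import Data.List.Relation.Unary.AllPairs using (AllPairs; []; _∷_)
import Data.List.Relation.Unary.AllPairs.Properties as AllPairs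
open import Data.List.Relation.Unary.Any as Any using (Any; here; there)
open import Data.Nat using (zero; suc; _+_; _<_; s≤s; z≤n; _<ᵇ_; >-nonZero)
open import Data.Nat.Properties using (≤-refl; ≤-reflexive; ≤-trans; <-≤-trans; <-irrefl; <⇒≤; m≤n⇒m≤1+n; +-identityʳ; +-suc; +-comm; +-mono-≤; *-monoʳ-≤; *-monoʳ-<; *-suc; ≤-pred; suc-injective; ≰⇒>; _≤?_; m^n>0; m<n⇒0<n∸m; suc-pred; <⇒<ᵇ)
open import Data.Product using (∃; _,_; proj₁; proj₂)
open import Data.Sum using (_⊎_; inj₁; inj₂; [_,_]′)
open import Function using (_∘_; case_of_)
open import Function.Bundles using (Equivalence)
open import Function.Definitions using (Injective)
open import Relation.Binary.Definitions using (tri<; tri≈; tri>)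
open import Relation.Binary.PropositionalEquality using (_≡_; _≢_; refl; sym; trans; cong; cong₂; subst)
open import Relation.Nullary using (¬_; Dec; yes; no; does; contradiction)
open import Relation.Nullary.Decidable using (_×-dec_; _⊎-dec_; ¬?; decidable-stable)
open import Relation.Unary using (Decidable)

-- Counting in lists

length≤filter+filter : ∀ {A : Set} {P Q : A → Set} (P? : Decidable P) (Q? : Decidable Q) {xs} →
  All (λ x → P x ⊎ Q x) xs → length xs ≤ length (filter P? xs) + length (filter Q? xs)
length≤filter+filter P? Q? [] = z≤n
length≤filter+filter P? Q? {x ∷ xs} (p⊎q ∷ pqs)
  with P? x | Q? x | length≤filter+filter P? Q? pqs
... | yes _ | yes _ | ih = s≤s (≤-trans ih (+-mono-≤ (≤-refl {length (filter P? xs)}) (m≤n⇒m≤1+n ≤-refl)))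
... | yes _ | no _  | ih = s≤s ih
... | no _  | yes _ | ih = ≤-trans (s≤s ih) (≤-reflexive (sym (+-suc _ _)))
... | no ¬p | no ¬q | ih = contradiction p⊎q [ ¬p , ¬q ]′

-- If both `a` and `b` were below `m`, their sum would miss `m + m` by at least two; hence a slack
-- of one is affordable.
pigeonhole : ∀ {m a b} → m + m ≤ suc (a + b) → m ≤ a ⊎ m ≤ b
pigeonhole {m} {a} {b} m+m≤ with m ≤? a | m ≤? b
... | yes m≤a | _       = inj₁ m≤a
... | no _    | yes m≤b = inj₂ m≤b
... | no m≰a  | no m≰b  = contradiction
  (<-≤-trans (≤-trans (s≤s (≤-reflexive (sym (+-suc a b)))) (+-mono-≤ (≰⇒> m≰a) (≰⇒> m≰b))) m+m≤)
  (<-irrefl refl)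

-- Arcs and adjacency

module _ {n : ℕ} (G : Digraph n) where

  Arc Adj : Fin n → Fin n → Set
  Arc u v = arc G u v ≡ true
  Adj u v = adj G u v ≡ true

  Arc? : ∀ u v → Dec (Arc u v)
  Arc? u v = arc G u v ≟ᵇ true

  Adj? : ∀ u v → Dec (Adj u v)
  Adj? u v = adj G u v ≟ᵇ true

  Adj-sym : ∀ {u v} → Adj u v → Adj v u
  Adj-sym {u} {v} uv = trans (∨-comm (arc G v u) (arc G u v)) uv

  Arc-asym : ∀ {u v} → Arc u v → ¬ Arc v u
  Arc-asym {u} {v} uv vu = case trans (sym vu) (asym G u v uv) of λ ()

  Arc⇒≢ : ∀ {u v} → Arc u v → u ≢ v
  Arc⇒≢ uu refl = Arc-asym uu uu

  Arc⇒Adj : ∀ {u v} → Arc u v → Adj u v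
  Arc⇒Adj uv rewrite uv = refl

  Adj⇒Arc : ∀ {u v} → Adj u v → Arc u v ⊎ Arc v u
  Adj⇒Arc {u} {v} uv with arc G u v
  ... | true  = inj₁ refl
  ... | false = inj₂ uv

  Adj⇒≢ : ∀ {u v} → Adj u v → u ≢ v
  Adj⇒≢ uv refl = [ (λ uu → Arc⇒≢ uu refl) , (λ uu → Arc⇒≢ uu refl) ]′ (Adj⇒Arc uv)

  -- Induced paths and induced cycles

  -- InducedPath y x l: the vertices of x ∷ l form, in this order, an induced path from x to y.
  data InducedPath (y : Fin n) : Fin n → List (Fin n) → Set where
    end  : InducedPath y y []
    step : ∀ {x z l} → Adj x z → All (λ t → ¬ (x ≡ t ⊎ Adj x t)) l →
           InducedPath y z l → InducedPath y x (z ∷ l)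

  -- Shortcut: `a` is joined to the last vertex of the path that it equals or touches, and
  -- everything before that vertex is dropped, so the new path has no chord at `a`.
  attach : ∀ {y a b l} {P : Fin n → Set} → Any (λ t → a ≡ t ⊎ Adj a t) (b ∷ l) →
    InducedPath y b l → All P (b ∷ l) → ∃ λ l′ → InducedPath y a l′ × All P l′
  attach (here (inj₁ refl)) end _ = _ , end , []
  attach (here (inj₂ ab)) end ps = _ , step ab [] end , ps
  attach {a = a} {b} {z ∷ l} t p@(step _ _ q) ps
    with Any.any? (λ t → (a ≟ t) ⊎-dec Adj? a t) (z ∷ l)
  ... | yes t′ = attach t′ q (All.tail ps)
  ... | no ¬t′ with t
  ...   | here (inj₁ refl) = _ , p , All.tail ps
  ...   | here (inj₂ ab)   = _ , step ab (¬Any⇒All¬ _ ¬t′) p , ps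
  ...   | there t′         = contradiction t′ ¬t′

  path-last : ∀ {y x l} → InducedPath y x l → lookup (x ∷ l) (fromℕ (length l)) ≡ y
  path-last end = refl
  path-last (step _ _ p) = path-last p

  path-injective : ∀ {y x l} → InducedPath y x l → Injective _≡_ _≡_ (lookup (x ∷ l))
  path-injective p {zero} {zero} _ = refl
  path-injective (step xz _ p) {zero} {suc zero} e = contradiction e (Adj⇒≢ xz)
  path-injective (step xz far p) {zero} {suc (suc j)} e =
    contradiction (inj₁ e) (All.lookup far (∈-lookup j))
  path-injective (step xz _ p) {suc zero} {zero} e = contradiction (sym e) (Adj⇒≢ xz)
  path-injective (step xz far p) {suc (suc j)} {zero} e =
    contradiction (inj₁ (sym e)) (All.lookup far (∈-lookup j))
  path-injective (step _ _ p) {suc i} {suc j} e = cong suc (path-injective p e)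

  Consecutive : ∀ {m} → Fin m → Fin m → Set
  Consecutive i j = suc (toℕ i) ≡ toℕ j ⊎ suc (toℕ j) ≡ toℕ i

  path-adj⇒ : ∀ {y x l} → InducedPath y x l → ∀ i j →
    Adj (lookup (x ∷ l) i) (lookup (x ∷ l) j) → Consecutive i j
  path-adj⇒ p zero zero xx = contradiction refl (Adj⇒≢ xx)
  path-adj⇒ (step _ _ _) zero (suc zero) _ = inj₁ refl
  path-adj⇒ (step _ far _) zero (suc (suc j)) xt =
    contradiction (inj₂ xt) (All.lookup far (∈-lookup j))
  path-adj⇒ (step _ _ _) (suc zero) zero _ = inj₂ refl
  path-adj⇒ (step _ far _) (suc (suc i)) zero tx =
    contradiction (inj₂ (Adj-sym tx)) (All.lookup far (∈-lookup i))
  path-adj⇒ (step _ _ p) (suc i) (suc j) st with path-adj⇒ p i j st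
  ... | inj₁ e = inj₁ (cong suc e)
  ... | inj₂ e = inj₂ (cong suc e)

  path-adj⇐ : ∀ {y x l} → InducedPath y x l → ∀ i j →
    Consecutive i j → Adj (lookup (x ∷ l) i) (lookup (x ∷ l) j)
  path-adj⇐ p zero zero (inj₁ ())
  path-adj⇐ p zero zero (inj₂ ())
  path-adj⇐ (step xz _ _) zero (suc zero) _ = xz
  path-adj⇐ (step _ _ _) zero (suc (suc j)) (inj₁ ())
  path-adj⇐ (step _ _ _) zero (suc (suc j)) (inj₂ ())
  path-adj⇐ (step xz _ _) (suc zero) zero _ = Adj-sym xz
  path-adj⇐ (step _ _ _) (suc (suc i)) zero (inj₁ ())
  path-adj⇐ (step _ _ _) (suc (suc i)) zero (inj₂ ())
  path-adj⇐ (step _ _ p) (suc i) (suc j) (inj₁ e) = path-adj⇐ p i j (inj₁ (suc-injective e))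
  path-adj⇐ (step _ _ p) (suc i) (suc j) (inj₂ e) = path-adj⇐ p i j (inj₂ (suc-injective e))

  CycAdj-sym : ∀ {m} {i j : Fin m} → CycAdj m i j → CycAdj m j i
  CycAdj-sym (inj₁ e) = inj₂ (inj₁ e)
  CycAdj-sym (inj₂ (inj₁ e)) = inj₁ e
  CycAdj-sym (inj₂ (inj₂ (inj₁ e))) = inj₂ (inj₂ (inj₂ e))
  CycAdj-sym (inj₂ (inj₂ (inj₂ e))) = inj₂ (inj₂ (inj₁ e))

  _≢?_ : (u v : Fin n) → Dec (u ≢ v)
  u ≢? v = ¬? (u ≟ v)

  Apart : Fin n → Fin n → Set
  Apart u v = u ≢ v × ¬ Adj u v

  Apart? : ∀ u v → Dec (Apart u v)
  Apart? u v = (u ≢? v) ×-dec ¬? (Adj? u v)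

  inducedCycle : ∀ {r x y l} → Adj r x → Adj r y → InducedPath y x l →
    All (λ t → Apart r t ⊎ t ≡ y) l → InducedCycle G (suc (suc (length l)))
  inducedCycle {r} {x} {y} {l} rx ry p away = lookup (r ∷ x ∷ l) , inj , λ i j → to i j , from i j
    where
    r≢ : ∀ j → r ≢ lookup (x ∷ l) j
    r≢ zero = Adj⇒≢ rx
    r≢ (suc j) with All.lookup away (∈-lookup j)
    ... | inj₁ (r≢t , _) = r≢t
    ... | inj₂ refl = Adj⇒≢ ry

    inj : Injective _≡_ _≡_ (lookup (r ∷ x ∷ l))
    inj {zero} {zero} _ = refl
    inj {zero} {suc j} e = contradiction e (r≢ j)
    inj {suc i} {zero} e = contradiction (sym e) (r≢ i)
    inj {suc i} {suc j} e = cong suc (path-injective p e)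

    -- `y` occurs on the path only at its end, so the one neighbour of `r` in `l` is the vertex that
    -- closes the cycle.
    last-index : ∀ j → lookup (x ∷ l) j ≡ y → toℕ j ≡ length l
    last-index j e = trans (cong toℕ (path-injective p (trans e (sym (path-last p))))) (toℕ-fromℕ _)

    to₀ : ∀ j → Adj r (lookup (x ∷ l) j) → CycAdj (suc (suc (length l))) zero (suc j)
    to₀ zero _ = inj₁ refl
    to₀ (suc j) rt with All.lookup away (∈-lookup j)
    ... | inj₁ (_ , ¬rt) = contradiction rt ¬rt
    ... | inj₂ t≡y = inj₂ (inj₂ (inj₁ (refl , cong (2 +_) (last-index (suc j) t≡y))))

    from₀ : ∀ j → CycAdj (suc (suc (length l))) zero (suc j) → Adj r (lookup (x ∷ l) j)
    from₀ zero _ = rx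
    from₀ (suc j) (inj₂ (inj₂ (inj₁ (_ , e)))) = subst (Adj r) (sym t≡y) ry
      where
      t≡y : lookup (x ∷ l) (suc j) ≡ y
      t≡y = trans (cong (lookup (x ∷ l)) (toℕ-injective
        (trans (suc-injective (suc-injective e)) (sym (toℕ-fromℕ (length l)))))) (path-last p)
    from₀ (suc j) (inj₁ ())
    from₀ (suc j) (inj₂ (inj₁ ()))
    from₀ (suc j) (inj₂ (inj₂ (inj₂ (() , _))))

    to : ∀ i j → Adj (lookup (r ∷ x ∷ l) i) (lookup (r ∷ x ∷ l) j) → CycAdj (suc (suc (length l))) i j
    to zero zero rr = contradiction refl (Adj⇒≢ rr)
    to zero (suc j) rt = to₀ j rt
    to (suc i) zero tr = CycAdj-sym {i = zero} {suc i} (to₀ i (Adj-sym tr))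
    to (suc i) (suc j) st with path-adj⇒ p i j st
    ... | inj₁ e = inj₁ (cong suc e)
    ... | inj₂ e = inj₂ (inj₁ (cong suc e))

    from : ∀ i j → CycAdj (suc (suc (length l))) i j → Adj (lookup (r ∷ x ∷ l) i) (lookup (r ∷ x ∷ l) j)
    from zero zero (inj₂ (inj₂ (inj₁ (_ , ()))))
    from zero zero (inj₂ (inj₂ (inj₂ (_ , ()))))
    from zero (suc j) e = from₀ j e
    from (suc i) zero e = Adj-sym (from₀ i (CycAdj-sym {i = suc i} {zero} e))
    from (suc i) (suc j) (inj₁ e) = path-adj⇐ p i j (inj₁ (suc-injective e))
    from (suc i) (suc j) (inj₂ (inj₁ e)) = path-adj⇐ p i j (inj₂ (suc-injective e))
    from (suc i) (suc j) (inj₂ (inj₂ (inj₁ (() , _))))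
    from (suc i) (suc j) (inj₂ (inj₂ (inj₂ (() , _))))

  -- Connected sets

  -- Connectivity of C, phrased as the induction principle it provides.
  Connected : List (Fin n) → Set₁
  Connected C = (Q : Fin n → Set) → (∀ {a b} → a ∈ C → b ∈ C → Adj a b → Q a → Q b) →
    ∀ {a b} → a ∈ C → b ∈ C → Q a → Q b

  connected-[_] : ∀ v → Connected [ v ]
  connected-[ v ] Q closed (here refl) (here refl) q = q

  connected-∷ : ∀ {y C} → Any (Adj y) C → Connected C → Connected (y ∷ C)
  connected-∷ {y} {C} touch conn Q closed = go
    where
    c = proj₁ (find touch)
    c∈C = proj₁ (proj₂ (find touch))
    yc = proj₂ (proj₂ (find touch))
    closed′ : ∀ {a b} → a ∈ C → b ∈ C → Adj a b → Q a → Q b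
    closed′ a∈C b∈C = closed (there a∈C) (there b∈C)
    go : ∀ {a b} → a ∈ y ∷ C → b ∈ y ∷ C → Q a → Q b
    go (here refl) (here refl) q = q
    go (here refl) (there b∈C) q = conn Q closed′ c∈C b∈C (closed (here refl) (there c∈C) yc q)
    go (there a∈C) (here refl) q =
      closed (there c∈C) (here refl) (Adj-sym yc) (conn Q closed′ a∈C c∈C q)
    go (there a∈C) (there b∈C) q = conn Q closed′ a∈C b∈C q

  -- Simplicial vertices and extendable colourings

  Simplicial : Fin n → List (Fin n) → Set
  Simplicial w S = ∀ {a b} → a ∈ S → b ∈ S → Adj w a → Adj w b → a ≢ b → Adj a b

  Far? : ∀ C z → Dec (All (Apart z) C)
  Far? C z = All.all? (Apart? z) C

  HasSimplicial : List (Fin n) → Set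
  HasSimplicial S = ∃ λ w → w ∈ S × Simplicial w S

  -- A certificate that the colour classes are acyclic, easier to extend by one vertex than the
  -- absence of directed cycles.
  Ranked : ∀ {b} → (Fin n → Fin b) → List (Fin n) → Set
  Ranked col S = ∃ λ (ρ : Fin n → ℕ) →
    ∀ a d → a ∈ S → d ∈ S → col a ≡ col d → Arc a d → ρ a < ρ d

  -- The interface between the greedy colouring and the excluded tournament: `K` stands for the
  -- coloured neighbours of `w`, and `c` is a colour for `w` that completes no monochromatic
  -- directed triangle.
  Extendable : ℕ → Set
  Extendable b = (col : Fin n → Fin b) → ∀ w K → (∀ {a} → a ∈ K → Adj w a) →
    (∀ {a d} → a ∈ K → d ∈ K → a ≢ d → Adj a d) →
    ∃ λ c → ∀ {a d} → a ∈ K → d ∈ K → col a ≡ c → col d ≡ c → Arc w a → Arc a d → ¬ Arc d w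

  -- Representatives of distinct colours are distinct vertices of a clique.
  rainbow-clique : ∀ {b} {K} (col : Fin n → Fin b) {f : Fin b → Fin n} →
    (∀ {a d} → a ∈ K → d ∈ K → a ≢ d → Adj a d) → (∀ c → f c ∈ K) → (∀ c → col (f c) ≡ c) →
    AllPairs Adj (tabulate f)
  rainbow-clique col clique f∈K colf = AllPairs.tabulate⁺ λ {i} {j} i≢j →
    clique (f∈K i) (f∈K j) λ fi≡fj → i≢j (trans (sym (colf i)) (trans (cong col fi≡fj) (colf j)))

  -- Chordal graphs have simplicial vertices

  module _ (chordal : Chordal G) where

    -- Otherwise x, an induced path from x to y inside C, and r would form a long induced cycle.
    neighbours-clique : ∀ {C r x y} → Connected C → All (Apart r) C → Any (Adj x) C → Any (Adj y) C →
      Adj r x → Adj r y → x ≢ y → Adj x y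
    neighbours-clique {C} {r} {x} {y} conn far xC yC rx ry x≢y = decidable-stable (Adj? x y) λ ¬xy →
      let (_ , p , inC) = path
      in chordal _ (long ¬xy p) (inducedCycle rx ry p (All.map weaken inC))
      where
      P : Fin n → Set
      P t = t ∈ C ⊎ t ≡ y

      Q : Fin n → Set
      Q a = ∃ λ l → InducedPath y a l × All P l

      closed : ∀ {a b} → a ∈ C → b ∈ C → Adj a b → Q a → Q b
      closed a∈C _ ab (_ , p , ps) = attach (here (inj₂ (Adj-sym ab))) p (inj₁ a∈C ∷ ps)

      path : Q x
      path with find xC | find yC
      ... | c , c∈C , xc | d , d∈C , yd
        -- The path is built backwards: from `y` to its neighbour `d`, through `C` to `c` by
        -- connectivity, and finally to `x`.
        with conn Q closed d∈C c∈C (attach (here (inj₂ (Adj-sym yd))) end (inj₂ refl ∷ []))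
      ... | _ , p , ps = attach (here (inj₂ xc)) p (inj₁ c∈C ∷ ps)

      weaken : ∀ {t} → P t → Apart r t ⊎ t ≡ y
      weaken (inj₁ t∈C) = inj₁ (All.lookup far t∈C)
      weaken (inj₂ t≡y) = inj₂ t≡y

      long : ∀ {l} → ¬ Adj x y → InducedPath y x l → 4 ≤ suc (suc (length l))
      long ¬xy end = contradiction refl x≢y
      long ¬xy (step xy _ end) = contradiction xy ¬xy
      long ¬xy (step _ _ (step _ _ _)) = s≤s (s≤s (s≤s (s≤s z≤n)))

    -- C grows as long as a vertex y touching it can be added with some far vertex surviving.
    -- The vertices touching the final C are then complete to the set of far vertices.
    -- U is a list of candidates for y; it may overlap C.
    grow : ∀ {S v} → (∀ {R r} → length R < length S → r ∈ R → HasSimplicial R) → v ∈ S →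
      ∀ m C U → length U < m → (∀ {z} → z ∈ S → z ∈ C ⊎ z ∈ U) → v ∈ C → Connected C →
      ∀ {r} → r ∈ S → All (Apart r) C → HasSimplicial S
    grow {S} {v} ih v∈S (suc m) C U |U|<m cover v∈C conn {r} r∈S far
      with Any.any? (λ y → Any.any? (Adj? y) C ×-dec
             Any.any? (λ r → Far? C r ×-dec ¬? (Adj? y r)) S) U
    ... | yes found with find found
    ...   | y , y∈U , touch , found′ with find found′
    ...     | r′ , r′∈S , far′ , ¬yr′ =
      grow ih v∈S m (y ∷ C) (filter (_≢? y) U)
        (<-≤-trans (filter-notAll (_≢? y) U (lose y∈U (λ y≢y → y≢y refl))) (≤-pred |U|<m))
        cover′ (there v∈C) (connected-∷ touch conn) r′∈S ((r′≢y , ¬yr′ ∘ Adj-sym) ∷ far′)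
      where
      cover′ : ∀ {z} → z ∈ S → z ∈ y ∷ C ⊎ z ∈ filter (_≢? y) U
      cover′ {z} z∈S with cover z∈S | z ≟ y
      ... | inj₁ z∈C | _ = inj₁ (there z∈C)
      ... | inj₂ z∈U | yes z≡y = inj₁ (here z≡y)
      ... | inj₂ z∈U | no z≢y = inj₂ (∈-filter⁺ (_≢? y) z∈U z≢y)
      r′≢y : r′ ≢ y
      r′≢y refl with find touch
      ... | c , c∈C , yc = proj₂ (All.lookup far′ c∈C) yc
    grow {S} {v} ih v∈S (suc m) C U |U|<m cover v∈C conn {r} r∈S far | no ¬found
      -- `v` lies in `C`, hence is not far from it, so the far vertices form a strictly smaller
      -- list.
      with ih (filter-notAll (Far? C) S (lose v∈S (λ v-far → proj₁ (All.lookup v-far v∈C) refl)))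
              (∈-filter⁺ (Far? C) r∈S far)
    ... | w , w∈R , simplicial = w , proj₁ (∈-filter⁻ (Far? C) w∈R) , simplicial′
      where
      w-far : All (Apart w) C
      w-far = proj₂ (∈-filter⁻ (Far? C) {xs = S} w∈R)

      -- A neighbour of `w` cannot lie in `C`, because `w` is far from `C`; so it either touches `C`
      -- or is far itself.
      classify : ∀ {a} → a ∈ S → Adj w a → (a ∈ U × Any (Adj a) C) ⊎ a ∈ filter (Far? C) S
      classify {a} a∈S wa with cover a∈S | Any.any? (Adj? a) C | Far? C a
      ... | inj₁ a∈C | _ | _ = contradiction wa (proj₂ (All.lookup w-far a∈C))
      ... | inj₂ a∈U | yes touch | _ = inj₁ (a∈U , touch)
      ... | inj₂ _ | no _ | yes a-far = inj₂ (∈-filter⁺ (Far? C) a∈S a-far)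
      ... | inj₂ _ | no ¬touch | no ¬far = contradiction
        (All.tabulate λ c∈C → (λ { refl → proj₂ (All.lookup w-far c∈C) wa }) , λ ac → ¬touch (lose c∈C ac))
        ¬far

      complete : ∀ {y r} → y ∈ U → Any (Adj y) C → r ∈ filter (Far? C) S → Adj y r
      complete {y} {r} y∈U touch r∈R with ∈-filter⁻ (Far? C) r∈R
      ... | r∈S , r-far = decidable-stable (Adj? y r) λ ¬yr →
        ¬found (lose y∈U (touch , lose r∈S (r-far , ¬yr)))

      simplicial′ : Simplicial w S
      simplicial′ a∈S b∈S wa wb a≢b with classify a∈S wa | classify b∈S wb
      -- Two touching vertices are adjacent by chordality, a touching and a far one by maximality of
      -- `C`, two far ones by induction.
      ... | inj₁ (_ , aC) | inj₁ (_ , bC) = neighbours-clique conn w-far aC bC wa wb a≢b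
      ... | inj₁ (a∈U , aC) | inj₂ b∈R = complete a∈U aC b∈R
      ... | inj₂ a∈R | inj₁ (b∈U , bC) = Adj-sym (complete b∈U bC a∈R)
      ... | inj₂ a∈R | inj₂ b∈R = simplicial a∈R b∈R wa wb a≢b

    -- If no two vertices are apart, `S` is a clique and any vertex serves; otherwise `grow` starts
    -- from one vertex of such a pair, with the other as far vertex.
    simplicial-vertex : ∀ m {S v} → length S < m → v ∈ S → HasSimplicial S
    simplicial-vertex (suc m) {S} {v} |S|<m v∈S with Any.any? (λ v → Any.any? (λ r → Apart? r v) S) S
    ... | yes found with find found
    ...   | u , u∈S , found′ with find found′
    ...     | r , r∈S , apart =
      grow (λ |R|<|S| → simplicial-vertex m (<-≤-trans |R|<|S| (≤-pred |S|<m))) u∈S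
        (suc (length S)) [ u ] S ≤-refl inj₂ (here refl) connected-[ u ] r∈S (apart ∷ [])
    simplicial-vertex (suc m) {S} {v} |S|<m v∈S | no ¬found = v , v∈S , λ a∈S b∈S _ _ a≢b →
      decidable-stable (Adj? _ _) λ ¬ab → ¬found (lose b∈S (lose a∈S (a≢b , ¬ab)))

    -- Greedy colouring along a simplicial elimination order

    module _ {b} (extend : Extendable b) (default : Fin n → Fin b) where

      -- If w gets a colour creating no monochromatic directed triangle at w, then all arcs
      -- between its in- and out-neighbours of that colour go from in to out, so the rank of w
      -- fits in between.
      ranked-colouring : ∀ m S → length S < m → ∃ λ col → Ranked {b} col S
      ranked-colouring m [] _ = default , (λ _ → 0) , λ _ _ ()
      ranked-colouring (suc m) S@(_ ∷ _) |S|<m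
        with simplicial-vertex (suc (length S)) {S} ≤-refl (here refl)
      ... | w , w∈S , simplicial
        with ranked-colouring m (filter (_≢? w) S)
               (<-≤-trans (filter-notAll (_≢? w) S (lose w∈S (λ w≢w → w≢w refl))) (≤-pred |S|<m))
      ... | col , ρ , increasing
        with extend col w (filter (Adj? w) S) (λ a∈K → proj₂ (∈-filter⁻ (Adj? w) {xs = S} a∈K))
               (λ a∈K d∈K → case ∈-filter⁻ (Adj? w) a∈K , ∈-filter⁻ (Adj? w) d∈K of λ
                 { ((a∈S , wa) , (d∈S , wd)) → simplicial a∈S d∈S wa wd })
      ... | c , no-triangle = col′ , ρ′ , increasing′
        where
        col′ : Fin n → Fin b
        col′ z = if does (z ≟ w) then c else col z

        In? : ∀ z → Dec (Arc z w × col z ≡ c)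
        In? z = Arc? z w ×-dec (col z ≟ c)

        M : ℕ
        M = max 0 (map (suc ∘ ρ) (filter In? S))

        ρ′ : Fin n → ℕ
        -- Old ranks become even and `w` gets an odd one: an in-neighbour of colour `c` has
        -- `2 * suc (ρ u) ≤ 2 * M`, and an out-neighbour has `M ≤ ρ x`, so its new rank is at least
        -- `2 * M + 2`.
        ρ′ z = if does (z ≟ w) then suc (2 * M) else 2 * suc (ρ z)

        in≤M : ∀ {u} → u ∈ S → Arc u w → col u ≡ c → suc (ρ u) ≤ M
        in≤M u∈S uw cu = All.lookup (xs≤max 0 _) (∈-map⁺ (suc ∘ ρ) (∈-filter⁺ In? u∈S (uw , cu)))

        M≤out : ∀ {x} → x ∈ S → Arc w x → col x ≡ c → M ≤ ρ x
        M≤out {x} x∈S wx cx = max≤v⁺ z≤n (All.map⁺ (All.tabulate below))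
          where
          x∈K = ∈-filter⁺ (Adj? w) x∈S (Arc⇒Adj wx)
          below : ∀ {u} → u ∈ filter In? S → ρ u < ρ x
          below {u} u∈ with ∈-filter⁻ In? {xs = S} u∈
          ... | u∈S , uw , cu
            with Adj⇒Arc (simplicial u∈S x∈S (Adj-sym (Arc⇒Adj uw)) (Arc⇒Adj wx) λ { refl → Arc-asym uw wx })
          ... | inj₁ ux = increasing u x (∈-filter⁺ (_≢? w) u∈S (Arc⇒≢ uw)) (∈-filter⁺ (_≢? w) x∈S (Arc⇒≢ wx ∘ sym))
                            (trans cu (sym cx)) ux
          ... | inj₂ xu = contradiction uw
            (no-triangle x∈K (∈-filter⁺ (Adj? w) u∈S (Adj-sym (Arc⇒Adj uw))) cx cu wx xu)

        increasing′ : ∀ a d → a ∈ S → d ∈ S → col′ a ≡ col′ d → Arc a d → ρ′ a < ρ′ d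
        increasing′ a d a∈S d∈S with a ≟ w | d ≟ w
        ... | yes refl | yes refl = λ _ aa → contradiction refl (Arc⇒≢ aa)
        ... | yes refl | no d≢w = λ c≡ wd →
          ≤-trans (≤-reflexive (sym (*-suc 2 M))) (*-monoʳ-≤ 2 (s≤s (M≤out d∈S wd (sym c≡))))
        ... | no a≢w | yes refl = λ ≡c aw → s≤s (*-monoʳ-≤ 2 (in≤M a∈S aw ≡c))
        ... | no a≢w | no d≢w = λ ca≡cd ad →
          *-monoʳ-< 2 (s≤s (increasing a d (∈-filter⁺ (_≢? w) a∈S a≢w) (∈-filter⁺ (_≢? w) d∈S d≢w) ca≡cd ad))

      dichromatic-bound : DichromaticAtMost G b
      dichromatic-bound with ranked-colouring (suc (length (allFin n))) (allFin n) ≤-refl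
      ... | col , ρ , increasing = col , acyclic
        where
        mono : ∀ {a u v} → col u ≡ a → col v ≡ a → Arc u v → ρ u < ρ v
        mono {u = u} {v} cu cv = increasing u v (∈-allFin u) (∈-allFin v) (trans cu (sym cv))

        -- Ranks do not drop from the first to the last vertex of a cycle, while the closing arc
        -- would force the first to exceed the last.
        walk : ∀ m (c : Fin (suc m) → Fin n) → (∀ i → ρ (c (inject₁ i)) < ρ (c (suc i))) →
          ρ (c zero) ≤ ρ (c (fromℕ m))
        walk zero c _ = ≤-refl
        walk (suc m) c incr = ≤-trans (<⇒≤ (incr zero)) (walk m (c ∘ suc) (incr ∘ suc))

        acyclic : ∀ a → ¬ DirectedCycleIn G (λ v → col v ≡ a)
        acyclic a (m , c , _ , ca , arcs , closing) = <-irrefl refl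
          (<-≤-trans (mono (ca (fromℕ m)) (ca zero) closing)
            (walk m c λ i → mono (ca (inject₁ i)) (ca (suc i)) (arcs i)))

  -- Transitive subtournaments and induced copies

  -- Of the at least `2 ^ suc j ∸ 1` vertices other than `v`, some `2 ^ j` are all out-neighbours or
  -- all in-neighbours of `v`; `v` is then put before or after the transitive list found among them.
  transitive-subtournament : ∀ j {l} → AllPairs Adj l → 2 ^ j ≤ length l →
    ∃ λ t → AllPairs Arc t × j < length t × All (_∈ l) t
  transitive-subtournament zero {v ∷ _} _ _ = [ v ] , [] ∷ [] , ≤-refl , here refl ∷ []
  transitive-subtournament (suc j) {[]} _ 2^≤0 = contradiction (≤-trans (m^n>0 2 (suc j)) 2^≤0) λ ()
  transitive-subtournament (suc j) {v ∷ l} (vl ∷ ll) 2^≤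
    with pigeonhole {2 ^ j} (≤-trans (≤-reflexive (cong (2 ^ j +_) (sym (+-identityʳ (2 ^ j)))))
           (≤-trans 2^≤ (s≤s (length≤filter+filter (Arc? v) (λ u → Arc? u v) (All.map Adj⇒Arc vl)))))
  ... | inj₁ many with transitive-subtournament j (AllPairs.filter⁺ (Arc? v) ll) many
  ...   | t , tt , j<t , t∈ = v ∷ t , All.map (λ u∈ → proj₂ (∈-filter⁻ (Arc? v) {xs = l} u∈)) t∈ ∷ tt , s≤s j<t ,
          here refl ∷ All.map (λ u∈ → there (proj₁ (∈-filter⁻ (Arc? v) u∈))) t∈
  transitive-subtournament (suc j) {v ∷ l} (vl ∷ ll) 2^≤ | inj₂ many
    with transitive-subtournament j (AllPairs.filter⁺ (λ u → Arc? u v) ll) many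
  ... | t , tt , j<t , t∈ = t ++ [ v ] ,
        AllPairs.++⁺ tt ([] ∷ []) (All.map (λ u∈ → proj₂ (∈-filter⁻ (λ u → Arc? u v) {xs = l} u∈) ∷ []) t∈) ,
        ≤-trans (s≤s j<t) (≤-reflexive (sym (trans (length-++ t) (+-comm (length t) 1)))) ,
        All.++⁺ (All.map (λ u∈ → there (proj₁ (∈-filter⁻ (λ u → Arc? u v) u∈))) t∈) (here refl ∷ [])

  lookup-transitive : ∀ {t} → AllPairs Arc t → ∀ i j → arc G (lookup t i) (lookup t j) ≡ (toℕ i <ᵇ toℕ j)
  lookup-transitive {v ∷ _} _ zero zero = irrefl G v
  lookup-transitive (vt ∷ _) zero (suc j) = All.lookup vt (∈-lookup j)
  lookup-transitive (vt ∷ _) (suc i) zero = asym G _ _ (All.lookup vt (∈-lookup i))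
  lookup-transitive (_ ∷ tt) (suc i) (suc j) = lookup-transitive tt i j

  transitive⇒TT : ∀ {k t} → AllPairs Arc t → k ≤ length t →
    ∃ λ (f : Fin k → Fin n) → (∀ i → f i ∈ t) × (∀ i j → arc G (f i) (f j) ≡ arc (TT k) i j)
  transitive⇒TT {t = t} tt k≤t = (λ i → lookup t (inject≤ i k≤t)) , (λ i → ∈-lookup _) , λ i j →
    trans (lookup-transitive tt (inject≤ i k≤t) (inject≤ j k≤t))
      (cong₂ _<ᵇ_ (toℕ-inject≤ i k≤t) (toℕ-inject≤ j k≤t))

  -- Injectivity comes for free: distinct vertices of `H` are adjacent, so their images are adjacent
  -- in the loopless `G`.
  tournament-copy : ∀ {h} (H : Digraph h) → (∀ u v → u ≡ v ⊎ adj H u v ≡ true) →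
    (f : Fin h → Fin n) → (∀ u v → arc G (f u) (f v) ≡ arc H u v) → ContainsInduced H G
  tournament-copy H tournament f f-arc = f , inj , f-arc
    where
    inj : Injective _≡_ _≡_ f
    inj {u} {v} e with tournament u v
    ... | inj₁ u≡v = u≡v
    ... | inj₂ uv = contradiction e (Adj⇒≢ (trans (cong₂ _∨_ (f-arc u v) (f-arc v u)) uv))

TT-tournament : ∀ k u v → u ≡ v ⊎ adj (TT k) u v ≡ true
TT-tournament k u v with <-cmp u v
... | tri≈ _ u≡v _ = inj₁ u≡v
... | tri< u<v _ _ rewrite Equivalence.to T-≡ (<⇒<ᵇ u<v) = inj₂ refl
... | tri> _ _ v<u rewrite Equivalence.to T-≡ (<⇒<ᵇ v<u) = inj₂ (∨-zeroʳ _)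

Δ11-tournament : ∀ k u v → u ≡ v ⊎ adj (Δ11 k) u v ≡ true
Δ11-tournament k zero zero = inj₁ refl
Δ11-tournament k zero (suc zero) = inj₂ refl
Δ11-tournament k zero (suc (suc t)) = inj₂ refl
Δ11-tournament k (suc zero) zero = inj₂ refl
Δ11-tournament k (suc zero) (suc zero) = inj₁ refl
Δ11-tournament k (suc zero) (suc (suc t)) = inj₂ refl
Δ11-tournament k (suc (suc s)) zero = inj₂ refl
Δ11-tournament k (suc (suc s)) (suc zero) = inj₂ refl
Δ11-tournament k (suc (suc s)) (suc (suc t)) with TT-tournament k s t
... | inj₁ s≡t = inj₁ (cong suc (cong suc s≡t))
... | inj₂ st = inj₂ st

module _ {n : ℕ} (G : Digraph n) where

  TT-copy : ∀ {k t} → AllPairs (Arc G) t → k ≤ length t → ContainsInduced (TT k) G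
  TT-copy {k} tt k≤t with transitive⇒TT G tt k≤t
  ... | f , _ , f-arc = tournament-copy G (TT k) (TT-tournament k) f f-arc

  Δ11-copy : ∀ {k x y t} → Arc G x y → AllPairs (Arc G) t → k ≤ length t →
    All (Arc G y) t → All (λ s → Arc G s x) t → ContainsInduced (Δ11 k) G
  Δ11-copy {k} {x} {y} {t} xy tt k≤t yt tx with transitive⇒TT G tt k≤t
  ... | f , f∈t , f-arc = tournament-copy G (Δ11 k) (Δ11-tournament k) g g-arc
    where
    g : Fin (suc (suc k)) → Fin n
    g zero = x
    g (suc zero) = y
    g (suc (suc i)) = f i

    g-arc : ∀ u v → arc G (g u) (g v) ≡ Δarc k u v
    g-arc zero zero = irrefl G x
    g-arc zero (suc zero) = xy
    g-arc zero (suc (suc j)) = asym G _ _ (All.lookup tx (f∈t j))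
    g-arc (suc zero) zero = asym G _ _ xy
    g-arc (suc zero) (suc zero) = irrefl G y
    g-arc (suc zero) (suc (suc j)) = All.lookup yt (f∈t j)
    g-arc (suc (suc i)) zero = All.lookup tx (f∈t i)
    g-arc (suc (suc i)) (suc zero) = asym G _ _ (All.lookup yt (f∈t i))
    g-arc (suc (suc i)) (suc (suc j)) = f-arc i j

  -- Finding a colour when a tournament is excluded

  TT-free⇒extendable : ∀ k → (G -free) (TT (suc k)) → Extendable G (2 ^ k ∸ 1)
  TT-free⇒extendable k free col w K wK clique with all? (λ c → Any.any? (λ a → col a ≟ c) K)
  ... | no ¬all with ¬∀⟶∃¬ _ _ (λ c → Any.any? (λ a → col a ≟ c) K) ¬all
  ...   | c , unused = c , λ a∈K _ ca _ _ _ _ → unused (lose a∈K ca)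
  TT-free⇒extendable k free col w K wK clique | yes all = contradiction copy free
    where
    f = λ c → proj₁ (find (all c))
    f∈K = λ c → proj₁ (proj₂ (find (all c)))
    colf = λ c → proj₂ (proj₂ (find (all c)))

    copy : ContainsInduced (TT (suc k)) G
    copy with transitive-subtournament G k {w ∷ tabulate f}
                (All.tabulate⁺ (λ c → wK (f∈K c)) ∷ rainbow-clique G col clique f∈K colf)
                -- One neighbour per colour gives `2 ^ k ∸ 1` vertices; `w` is the one still
                -- missing.
                (≤-reflexive (trans (sym (suc-pred (2 ^ k) {{>-nonZero (m^n>0 2 k)}})) (cong suc (sym (length-tabulate f)))))
    ... | t , tt , k<t , _ = TT-copy tt k<t

  -- The middle vertex `a` may have any colour. A colour containing no such `d` is therefore safe
  -- for `w`, and a blocked colour still supplies the vertices needed for a copy of Δ(1,1,k).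
  ClosesTriangle : Fin n → List (Fin n) → Fin n → Set
  ClosesTriangle w K d = Arc G d w × Any (λ a → Arc G w a × Arc G a d) K

  ClosesTriangle? : ∀ w K d → Dec (ClosesTriangle w K d)
  ClosesTriangle? w K d = Arc? G d w ×-dec Any.any? (λ a → Arc? G w a ×-dec Arc? G a d) K

  Δ11-free⇒extendable : ∀ k → (G -free) (Δ11 (suc k)) → Extendable G (2 ^ (2 * k))
  Δ11-free⇒extendable k free col w K wK clique
    with all? (λ c → Any.any? (λ d → (col d ≟ c) ×-dec ClosesTriangle? w K d) K)
  ... | no ¬all with ¬∀⟶∃¬ _ _ (λ c → Any.any? (λ d → (col d ≟ c) ×-dec ClosesTriangle? w K d) K) ¬all
  ...   | c , free-colour = c , λ a∈K d∈K _ cd wa ad dw →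
          free-colour (lose d∈K (cd , dw , lose a∈K (wa , ad)))
  Δ11-free⇒extendable k free col w K wK clique | yes all = contradiction copy free
    where
    f = λ c → proj₁ (find (all c))
    f∈K = λ c → proj₁ (proj₂ (find (all c)))
    colf = λ c → proj₁ (proj₂ (proj₂ (find (all c))))

    closing : ∀ {d} → d ∈ tabulate f → d ∈ K × ClosesTriangle w K d
    closing d∈ with ∈-tabulate⁻ d∈
    ... | c , refl = f∈K c , proj₂ (proj₂ (proj₂ (find (all c))))

    copy : ContainsInduced (Δ11 (suc k)) G
    copy with transitive-subtournament G (2 * k) (rainbow-clique G col clique f∈K colf)
                (≤-reflexive (sym (length-tabulate f)))
    -- The head `d` is the source; at least `2 * k` vertices remain, to be split by the direction of
    -- their arcs with `a`.
    ... | d ∷ ds , dds ∷ dss , s≤s 2k≤ds , d∈ ∷ ds∈ with closing d∈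
    ...   | _ , dw , any-a with find any-a
    ...     | a , a∈K , wa , ad = split
      (pigeonhole {k} (≤-trans (≤-reflexive (cong (k +_) (sym (+-identityʳ k))))
        (≤-trans 2k≤ds (m≤n⇒m≤1+n (length≤filter+filter (Arc? G a) (λ e → Arc? G e a) a~ds)))))
      where
      ds→w : All (λ e → Arc G e w) ds
      ds→w = All.map (λ e∈ → proj₁ (proj₂ (closing e∈))) ds∈

      a~ds : All (λ e → Arc G a e ⊎ Arc G e a) ds
      a~ds = All.zipWith (λ (de , e∈) → Adj⇒Arc G
        -- `a` differs from each `e`, as `a → d` but `d → e`.
        (clique a∈K (proj₁ (closing e∈)) λ { refl → Arc-asym G ad de })) (dds , ds∈)

      split : k ≤ length (filter (Arc? G a) ds) ⊎ k ≤ length (filter (λ e → Arc? G e a) ds) →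
        ContainsInduced (Δ11 (suc k)) G
      split (inj₁ many) = Δ11-copy {x = w} {a} wa
        (All.filter⁺ (Arc? G a) dds ∷ AllPairs.filter⁺ (Arc? G a) dss) (s≤s many)
        (ad ∷ all-filter (Arc? G a) ds) (dw ∷ All.filter⁺ (Arc? G a) ds→w)
      -- All of `ds` point to `w`, so `w` can be appended as the sink, giving `suc k` vertices.
      split (inj₂ many) = Δ11-copy {x = a} {d} ad
        (AllPairs.++⁺ (AllPairs.filter⁺ P? dss) ([] ∷ []) (All.map (_∷ []) (All.filter⁺ P? ds→w)))
        (≤-trans (s≤s many) (≤-reflexive (sym (trans (length-++ (filter P? ds)) (+-comm _ 1)))))
        (All.++⁺ (All.filter⁺ P? dds) (dw ∷ []))
        (All.++⁺ (all-filter P? ds) (wa ∷ []))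
        where
        P? = λ e → Arc? G e a

theorem2p5 : (k : ℕ) → 1 ≤ k →
    ((n : ℕ) (G : Digraph n) → Chordal G → (G -free) (TT k) →
    DichromaticAtMost G (2 ^ (k ∸ 1) ∸ 1))
    × ((n : ℕ) (G : Digraph n) → Chordal G → (G -free) (Δ11 k) →
    DichromaticAtMost G (2 ^ (2 * k ∸ 2)))
theorem2p5 (suc k) _ = transitive , triangular
  where
  default : ∀ {n} (G : Digraph n) k → (G -free) (TT (suc k)) → Fin n → Fin (2 ^ k ∸ 1)
  -- With no colours available there must be no vertex: a single one would be a copy of `TT 1`.
  default G zero free v = contradiction (TT-copy G {t = [ v ]} ([] ∷ []) ≤-refl) free
  default G (suc k) _ _ = fromℕ< {0} (m<n⇒0<n∸m (*-monoʳ-≤ 2 (m^n>0 2 k)))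

  transitive : ∀ n (G : Digraph n) → Chordal G → (G -free) (TT (suc k)) → DichromaticAtMost G (2 ^ k ∸ 1)
  transitive n G chordal free =
    dichromatic-bound G chordal (TT-free⇒extendable G k free) (default G k free)

  triangular : ∀ n (G : Digraph n) → Chordal G → (G -free) (Δ11 (suc k)) →
    DichromaticAtMost G (2 ^ (2 * suc k ∸ 2))
  -- Rewriting `2 * suc k` as `2 + 2 * k` lets the subtraction compute to `2 * k`.
  triangular n G chordal free = subst (λ e → DichromaticAtMost G (2 ^ (e ∸ 2))) (sym (*-suc 2 k))
    (dichromatic-bound G chordal (Δ11-free⇒extendable G k free) (λ _ → fromℕ< (m^n>0 2 (2 * k))))
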